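{- Let $1\le i\le n$ be integers. The fixed interval vector polytope $\mathcal{P}_n(\mathcal{I}_i)\subset\mathbb{R}^n$, i.e. the convex hull of the vectors $\alpha_{k,k+i-1}=e_k+e_{k+1}+\dots+e_{k+i-1}$ for $1\le k\le n-i+1$, is an $(n-i)$-dimensional unimodular simplex.
   Context: Here $e_k$ denotes the $k$-th standard unit vector of $\mathbb{R}^n$. The vectors $\alpha_{k,k+i-1}$ are exactly the $(0,1)$-vectors in $\mathbb{R}^n$ having exactly $i$ ones, all of which appear consecutively (interval vectors of interval length $i$). A $d$-dimensional polytope is a $d$-simplex if it has $d+1$ vertices. A unimodular simplex in $\mathbb{R}^n$ is a lattice simplex $\Delta$ (vertices in $\mathbb{Z}^n$) whose edge directions at any vertex $v$ (the vectors $w-v$ for the other vertices $w$) form a lattice basis for $\mathbb{Z}^n\cap\operatorname{aff}(\Delta)$, where $\operatorname{aff}(\Delta)$ is the affine hull of $\Delta$; that is, every point of $\mathbb{Z}^n\cap\operatorname{aff}(\Delta)$ is $v$ plus a unique integer linear combination of these edge directions. -}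

module Defs where

open import Algebra.Bundles using (CommutativeRing)
open import Algebra.Bundles.Raw using (RawMonoid)
import Algebra.Definitions.RawMonoid as RawMonoidOps
import Algebra.Properties.CommutativeSemigroup as CommutativeSemigroupProperties
open import Data.Bool using (if_then_else_)
open import Data.Fin using (Fin; toℕ; punchIn)
open import Data.Integer using (ℤ)
open import Data.Nat as ℕ using (ℕ; suc; _∸_; _≡ᵇ_; _⊔_)
import Data.Nat.Properties as ℕ
open import Data.Product using (_×_; _,_; ∃; ∃-syntax; ∃!)
open import Data.Rational as ℚ using (ℚ; 0ℚ; 1ℚ; ½; ∣_∣)
import Data.Rational.Properties as ℚ
open import Data.Vec.Functional using (Vector)
open import Level using (0ℓ)
open import Relation.Binary.PropositionalEquality
  using (_≡_; sym; trans; cong; cong₂; subst; _≗_; module ≡-Reasoning)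
open import Relation.Unary using (Pred; _∈_; _⊆_; _≐_; _∩_)

-- Reals are represented by Cauchy sequences of rationals; equality of reals
-- is the setoid equality _≈_, and points of ℝⁿ are compared coordinatewise
-- by _≋_.

IsCauchy : (ℕ → ℚ) → Set
IsCauchy f = ∀ {ε} → 0ℚ ℚ.< ε →
  ∃[ N ] (∀ {m n} → N ℕ.≤ m → N ℕ.≤ n → ∣ f m ℚ.- f n ∣ ℚ.< ε)

record ℝ : Set where
  constructor mkℝ
  field
    seq    : ℕ → ℚ
    cauchy : IsCauchy seq

open ℝ public

infix 4 _≈_ _≤_

record _≈_ (x y : ℝ) : Set where
  constructor mk≈
  field
    close : ∀ {ε} → 0ℚ ℚ.< ε →
      ∃[ N ] (∀ {n} → N ℕ.≤ n → ∣ seq x n ℚ.- seq y n ∣ ℚ.< ε)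

record _≤_ (x y : ℝ) : Set where
  constructor mk≤
  field
    below : ∀ {ε} → 0ℚ ℚ.< ε →
      ∃[ N ] (∀ {n} → N ℕ.≤ n → seq x n ℚ.< seq y n ℚ.+ ε)

open _≈_ public
open _≤_ public

fromℚ : ℚ → ℝ
fromℚ q = mkℝ (λ _ → q) λ {ε} ε>0 →
  0 , λ _ _ → subst (λ z → ∣ z ∣ ℚ.< ε) (sym (ℚ.+-inverseʳ q)) ε>0

fromℤ : ℤ → ℝ
fromℤ z = fromℚ (z ℚ./ 1)

0ℝ 1ℝ : ℝ
0ℝ = fromℚ 0ℚ
1ℝ = fromℚ 1ℚ

private
  module ℚ-algebra where
    open import Data.Rational using (_+_; _-_; _*_; -_)
    open import Data.Rational.Properties
    open CommutativeSemigroupProperties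
      (CommutativeRing.+-commutativeSemigroup +-*-commutativeRing)
      using (interchange)

    +-−-interchange : ∀ a b c d → (a + b) - (c + d) ≡ (a - c) + (b - d)
    +-−-interchange a b c d =
      trans (cong (a + b +_) (neg-distrib-+ c d)) (interchange a b (- c) (- d))

    ≡+− : ∀ a b → a ≡ b + (a - b)
    ≡+− a b = sym (begin
      b + (a - b)      ≡⟨ +-comm b (a - b) ⟩
      (a - b) + b      ≡⟨ +-assoc a (- b) b ⟩
      a + (- b + b)    ≡⟨ cong (a +_) (+-inverseˡ b) ⟩
      a + 0ℚ           ≡⟨ +-identityʳ a ⟩
      a                ∎)
      where open ≡-Reasoning

    *-−-split : ∀ a b c d → a * b - c * d ≡ a * (b - d) + d * (a - c)
    *-−-split a b c d = sym (begin
      a * (b - d) + d * (a - c)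
        ≡⟨ cong₂ _+_ (*-distribˡ-+ a b (- d))
                     (trans (*-comm d (a - c)) (*-distribʳ-+ d a (- c))) ⟩
      (a * b + a * - d) + (a * d + - c * d)
        ≡⟨ +-assoc (a * b) (a * - d) (a * d + - c * d) ⟩
      a * b + (a * - d + (a * d + - c * d))
        ≡⟨ cong (a * b +_) (+-assoc (a * - d) (a * d) (- c * d)) ⟨
      a * b + ((a * - d + a * d) + - c * d)
        ≡⟨ cong (λ z → a * b + (z + - c * d))
             (trans (sym (*-distribˡ-+ a (- d) d))
                    (trans (cong (a *_) (+-inverseˡ d)) (*-zeroʳ a))) ⟩
      a * b + (0ℚ + - c * d)
        ≡⟨ cong (a * b +_) (trans (+-identityˡ (- c * d)) (sym (neg-distribˡ-* c d))) ⟩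
      a * b - c * d ∎)
      where open ≡-Reasoning

  open ℚ-algebra

  half-pos : ∀ {ε} → 0ℚ ℚ.< ε → 0ℚ ℚ.< ½ ℚ.* ε
  half-pos {ε} ε>0 = ℚ.positive⁻¹ _ {{ℚ.pos*pos⇒pos ½ ε {{ℚ.positive ε>0}}}}

  halves : ∀ ε → ½ ℚ.* ε ℚ.+ ½ ℚ.* ε ≡ ε
  halves ε = trans (sym (ℚ.*-distribʳ-+ ε ½ ½)) (ℚ.*-identityˡ ε)

+-cauchy : ∀ x y → IsCauchy (λ n → seq x n ℚ.+ seq y n)
+-cauchy x@(mkℝ f _) y@(mkℝ g _) {ε} ε>0 =
  let M , hf = cauchy x (half-pos ε>0)
      N , hg = cauchy y (half-pos ε>0)
  in M ⊔ N , λ {m} {n} p q → begin-strict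
  ∣ (f m ℚ.+ g m) ℚ.- (f n ℚ.+ g n) ∣
    ≡⟨ cong ∣_∣ (+-−-interchange (f m) (g m) (f n) (g n)) ⟩
  ∣ (f m ℚ.- f n) ℚ.+ (g m ℚ.- g n) ∣
    ≤⟨ ℚ.∣p+q∣≤∣p∣+∣q∣ (f m ℚ.- f n) (g m ℚ.- g n) ⟩
  ∣ f m ℚ.- f n ∣ ℚ.+ ∣ g m ℚ.- g n ∣
    <⟨ ℚ.+-mono-< (hf (ℕ.m⊔n≤o⇒m≤o M N p) (ℕ.m⊔n≤o⇒m≤o M N q))
                  (hg (ℕ.m⊔n≤o⇒n≤o M N p) (ℕ.m⊔n≤o⇒n≤o M N q)) ⟩
  ½ ℚ.* ε ℚ.+ ½ ℚ.* ε
    ≡⟨ halves ε ⟩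
  ε ∎
  where open ℚ.≤-Reasoning

-‿cauchy : ∀ x → IsCauchy (λ n → ℚ.- seq x n)
-‿cauchy x@(mkℝ f _) {ε} ε>0 =
  let N , hf = cauchy x ε>0
  in N , λ {m} {n} p q →
    subst (λ z → z ℚ.< ε)
          (trans (sym (ℚ.∣-p∣≡∣p∣ (f m ℚ.- f n)))
                 (cong ∣_∣ (ℚ.neg-distrib-+ (f m) (ℚ.- f n))))
          (hf p q)

eventually-bounded : ∀ x →
  ∃[ B ] (0ℚ ℚ.< B × ∃[ N ] (∀ {n} → N ℕ.≤ n → ∣ seq x n ∣ ℚ.< B))
eventually-bounded x@(mkℝ f _) =
  let N , h = cauchy x (ℚ.positive⁻¹ 1ℚ)
  in ∣ f N ∣ ℚ.+ 1ℚ ,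
     ℚ.+-mono-≤-< (ℚ.0≤∣p∣ (f N)) (ℚ.positive⁻¹ 1ℚ) ,
     N , λ {n} p → begin-strict
       ∣ f n ∣                        ≡⟨ cong ∣_∣ (≡+− (f n) (f N)) ⟩
       ∣ f N ℚ.+ (f n ℚ.- f N) ∣      ≤⟨ ℚ.∣p+q∣≤∣p∣+∣q∣ (f N) (f n ℚ.- f N) ⟩
       ∣ f N ∣ ℚ.+ ∣ f n ℚ.- f N ∣    <⟨ ℚ.+-monoʳ-< ∣ f N ∣ (h p ℕ.≤-refl) ⟩
       ∣ f N ∣ ℚ.+ 1ℚ                 ∎
  where open ℚ.≤-Reasoning

private
  ∣*∣-< : ∀ p q B δ → 0ℚ ℚ.< δ → ∣ p ∣ ℚ.< B → ∣ q ∣ ℚ.< δ →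
          ∣ p ℚ.* q ∣ ℚ.< B ℚ.* δ
  ∣*∣-< p q B δ δ>0 p<B q<δ = begin-strict
    ∣ p ℚ.* q ∣        ≡⟨ ℚ.∣p*q∣≡∣p∣*∣q∣ p q ⟩
    ∣ p ∣ ℚ.* ∣ q ∣    ≤⟨ ℚ.*-monoˡ-≤-nonNeg ∣ p ∣
                            {{ℚ.nonNegative (ℚ.0≤∣p∣ p)}} (ℚ.<⇒≤ q<δ) ⟩
    ∣ p ∣ ℚ.* δ        <⟨ ℚ.*-monoˡ-<-pos δ {{ℚ.positive δ>0}} p<B ⟩
    B ℚ.* δ            ∎
    where open ℚ.≤-Reasoning

  divide : ∀ {C ε} → 0ℚ ℚ.< C → 0ℚ ℚ.< ε → ∃[ δ ] (0ℚ ℚ.< δ × C ℚ.* δ ≡ ε)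
  divide {C} {ε} C>0 ε>0 = C⁻¹ ℚ.* ε ,
    ℚ.positive⁻¹ _ {{ℚ.pos*pos⇒pos C⁻¹ {{ℚ.1/pos⇒pos C}} ε {{ℚ.positive ε>0}}}} ,
    trans (sym (ℚ.*-assoc C C⁻¹ ε))
          (trans (cong (ℚ._* ε) (ℚ.*-inverseʳ C)) (ℚ.*-identityˡ ε))
    where
    instance
      C-pos = ℚ.positive C>0
      C-nz  = ℚ.pos⇒nonZero C
    C⁻¹ = ℚ.1/ C

*-cauchy : ∀ x y → IsCauchy (λ n → seq x n ℚ.* seq y n)
*-cauchy x@(mkℝ f _) y@(mkℝ g _) {ε} ε>0 =
  let A , A>0 , M₁ , f<A   = eventually-bounded x
      B , B>0 , N₁ , g<B   = eventually-bounded y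
      δ , δ>0 , [A+B]δ≡ε   = divide (ℚ.+-mono-< A>0 B>0) ε>0
      M₂ , hf              = cauchy x δ>0
      N₂ , hg              = cauchy y δ>0
      M = M₁ ⊔ M₂
      N = N₁ ⊔ N₂
      ≥M = λ {k} (p : M ⊔ N ℕ.≤ k) → ℕ.m⊔n≤o⇒m≤o M N p
      ≥N = λ {k} (p : M ⊔ N ℕ.≤ k) → ℕ.m⊔n≤o⇒n≤o M N p
  in M ⊔ N , λ {m} {n} p q → begin-strict
  ∣ f m ℚ.* g m ℚ.- f n ℚ.* g n ∣
    ≡⟨ cong ∣_∣ (*-−-split (f m) (g m) (f n) (g n)) ⟩
  ∣ f m ℚ.* (g m ℚ.- g n) ℚ.+ g n ℚ.* (f m ℚ.- f n) ∣
    ≤⟨ ℚ.∣p+q∣≤∣p∣+∣q∣ (f m ℚ.* (g m ℚ.- g n)) (g n ℚ.* (f m ℚ.- f n)) ⟩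
  ∣ f m ℚ.* (g m ℚ.- g n) ∣ ℚ.+ ∣ g n ℚ.* (f m ℚ.- f n) ∣
    <⟨ ℚ.+-mono-<
         (∣*∣-< (f m) (g m ℚ.- g n) A δ δ>0
                (f<A (ℕ.m⊔n≤o⇒m≤o M₁ M₂ (≥M p)))
                (hg (ℕ.m⊔n≤o⇒n≤o N₁ N₂ (≥N p)) (ℕ.m⊔n≤o⇒n≤o N₁ N₂ (≥N q))))
         (∣*∣-< (g n) (f m ℚ.- f n) B δ δ>0
                (g<B (ℕ.m⊔n≤o⇒m≤o N₁ N₂ (≥N q)))
                (hf (ℕ.m⊔n≤o⇒n≤o M₁ M₂ (≥M p)) (ℕ.m⊔n≤o⇒n≤o M₁ M₂ (≥M q)))) ⟩
  A ℚ.* δ ℚ.+ B ℚ.* δ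
    ≡⟨ sym (ℚ.*-distribʳ-+ δ A B) ⟩
  (A ℚ.+ B) ℚ.* δ
    ≡⟨ [A+B]δ≡ε ⟩
  ε ∎
  where open ℚ.≤-Reasoning

infixl 6 _+_ _-_
infixl 7 _*_
infix  8 -_

_+_ : ℝ → ℝ → ℝ
seq    (x + y) n = seq x n ℚ.+ seq y n
cauchy (x + y)   = +-cauchy x y

-_ : ℝ → ℝ
seq    (- x) n = ℚ.- seq x n
cauchy (- x)   = -‿cauchy x

_-_ : ℝ → ℝ → ℝ
x - y = x + (- y)

_*_ : ℝ → ℝ → ℝ
seq    (x * y) n = seq x n ℚ.* seq y n
cauchy (x * y)   = *-cauchy x y

+-rawMonoid : RawMonoid 0ℓ 0ℓ
+-rawMonoid = record { Carrier = ℝ ; _≈_ = _≈_ ; _∙_ = _+_ ; ε = 0ℝ }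

open RawMonoidOps +-rawMonoid public using (sum)

Point : ℕ → Set
Point n = Vector ℝ n

private
  variable
    d m n : ℕ

infix  4 _≋_
infixl 6 _⊕_ _⊖_
infix  8 _·_

_≋_ : Point n → Point n → Set
x ≋ y = ∀ t → x t ≈ y t

_⊕_ _⊖_ : Point n → Point n → Point n
(x ⊕ y) t = x t + y t
(x ⊖ y) t = x t - y t

_·_ : Point n → Point n → ℝ
x · y = sum (λ t → x t * y t)

𝟎 : Point n
𝟎 _ = 0ℝ

vsum : (Fin m → Point n) → Point n
vsum p t = sum (λ j → p j t)

lincomb : (Fin m → ℝ) → (Fin m → Point n) → Point n
lincomb c p = vsum (λ j t → c j * p j t)

ℤ-lattice : Pred (Point n) 0ℓ
ℤ-lattice x = ∀ t → ∃[ z ] x t ≈ fromℤ z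

Range : (Fin m → Point n) → Pred (Point n) 0ℓ
Range p x = ∃[ j ] x ≋ p j

aff : Pred (Point n) 0ℓ → Pred (Point n) 0ℓ
aff {n} S x =
  ∃[ m ] ∃ λ (p : Fin m → Point n) → ∃ λ (c : Fin m → ℝ) →
    (∀ j → p j ∈ S) × sum c ≈ 1ℝ × x ≋ lincomb c p

conv : Pred (Point n) 0ℓ → Pred (Point n) 0ℓ
conv {n} S x =
  ∃[ m ] ∃ λ (p : Fin m → Point n) → ∃ λ (c : Fin m → ℝ) →
    (∀ j → p j ∈ S) × (∀ j → 0ℝ ≤ c j) × sum c ≈ 1ℝ × x ≋ lincomb c p

AffinelyIndependent : (Fin m → Point n) → Set
AffinelyIndependent {m} p = ∀ (c : Fin m → ℝ) →
  sum c ≈ 0ℝ → lincomb c p ≋ 𝟎 → ∀ j → c j ≈ 0ℝ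

-- The dimension of S is that of its affine hull: aff S has an affine basis
-- of d + 1 points.
HasDimension : Pred (Point n) 0ℓ → ℕ → Set
HasDimension {n} S d =
  ∃ λ (p : Fin (suc d) → Point n) →
    (∀ j → p j ∈ aff S) × AffinelyIndependent p × aff S ⊆ aff (Range p)

IsPolytope : Pred (Point n) 0ℓ → Set
IsPolytope {n} P = ∃[ m ] ∃ λ (p : Fin m → Point n) → P ≐ conv (Range p)

-- {v} is a face of P: some linear functional attains its maximum over P
-- exactly at v.
IsVertex : Pred (Point n) 0ℓ → Pred (Point n) 0ℓ
IsVertex {n} P v =
  v ∈ P ×
  ∃ λ (a : Point n) →
    (∀ {x} → x ∈ P → a · x ≤ a · v) ×
    (∀ {x} → x ∈ P → a · x ≈ a · v → x ≋ v)

record Enumerates (w : Fin m → Point n) (S : Pred (Point n) 0ℓ) : Set where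
  field
    sound     : ∀ k → w k ∈ S
    complete  : S ⊆ Range w
    injective : ∀ {j k} → w j ≋ w k → j ≡ k

record IsSimplex {n} (d : ℕ) (P : Pred (Point n) 0ℓ) : Set where
  field
    polytope   : IsPolytope P
    dimension  : HasDimension P d
    vertex     : Fin (suc d) → Point n
    enumerates : Enumerates vertex (IsVertex P)

IsLatticeBasisAt : Point n → (Fin d → Point n) → Pred (Point n) 0ℓ → Set
IsLatticeBasisAt {d = d} v u L = ∀ {x} → x ∈ L →
  ∃! _≗_ λ (a : Fin d → ℤ) → x ≋ v ⊕ lincomb (λ j → fromℤ (a j)) u

record IsUnimodularSimplex {n} (d : ℕ) (Δ : Pred (Point n) 0ℓ) : Set where
  field
    simplex : IsSimplex d Δ

  open IsSimplex simplex public

  edge : Fin (suc d) → Fin d → Point n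
  edge k j = vertex (punchIn k j) ⊖ vertex k

  field
    lattice : ∀ k → vertex k ∈ ℤ-lattice
    basis   : ∀ k → IsLatticeBasisAt (vertex k) (edge k) (ℤ-lattice ∩ aff Δ)

-- Unit vectors are numbered from 1, so coordinate t : Fin n has number
-- suc (toℕ t); e k is the k-th unit vector when 1 ≤ k ≤ n.
e : ℕ → Point n
e k t = if k ≡ᵇ suc (toℕ t) then 1ℝ else 0ℝ

-- α k l = e k + e (k + 1) + ⋯ + e l
α : ℕ → ℕ → Point n
α k l = vsum (λ (j : Fin (suc l ∸ k)) → e (k ℕ.+ toℕ j))

ℐ : ∀ n → ℕ → Pred (Point n) 0ℓ
ℐ n i x = ∃[ k ] (1 ℕ.≤ k × k ℕ.≤ n ∸ i ℕ.+ 1 × x ≋ α k (k ℕ.+ i ∸ 1))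

𝒫 : ∀ n → Pred (Point n) 0ℓ → Pred (Point n) 0ℓ
𝒫 n I = conv I

{-# OPTIONS --safe #-}

-- The j-th interval vector has its first 1 at coordinate j, so the first n − i + 1
-- coordinates of the interval vectors form a unitriangular matrix. Column reduction
-- inverts it over ℤ and yields integral functionals φⱼ dual to the vectors vⱼ:
-- φⱼ · vₖ = δⱼₖ. Hence x ↦ (φⱼ · x)ⱼ are barycentric coordinates on the affine hull:
-- they show affine independence, φₖ exposes vₖ as a vertex, and they are integers at
-- lattice points, which gives the lattice bases.

module Submission where

open import Algebra.Bundles using (CommutativeRing)
import Algebra.Properties.AbelianGroup as AbelianGroupProperties
import Algebra.Properties.CommutativeSemigroup as CommutativeSemigroupProperties
import Algebra.Properties.Ring as RingProperties
import Algebra.Properties.Semiring.Sum as Sum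
open import Data.Bool using (true; false; if_then_else_)
open import Data.Fin as Fin using (Fin; zero; suc; toℕ; punchIn; fromℕ<; inject≤)
import Data.Fin.Properties as Fin
open import Data.Integer as ℤ using (ℤ; 0ℤ; 1ℤ)
import Data.Integer.Properties as ℤ
open import Data.Nat as ℕ using (ℕ; suc; _⊔_; _≡ᵇ_; z≤n; s≤s)
import Data.Nat.Properties as ℕ
open import Data.Product using (_×_; _,_; ∃; ∃-syntax; proj₁; proj₂)
open import Data.Rational as ℚ using (ℚ; 0ℚ; 1ℚ; ½; ∣_∣; toℚᵘ)
import Data.Rational.Properties as ℚ
open import Data.Rational.Solver using (module +-*-Solver)
open import Data.Rational.Unnormalised as ℚᵘ using (mkℚᵘ; *≡*)
import Data.Rational.Unnormalised.Properties as ℚᵘ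
open import Data.Sum using (_⊎_; inj₁; inj₂)
open import Data.Unit using (tt)
open import Data.Vec.Functional using (Vector)
open import Function using (_∘_)
open import Level as Level using (0ℓ)
open import Relation.Binary.PropositionalEquality as ≡ using (_≡_; _≢_)
open import Relation.Nullary using (Dec; yes; no; does; ¬_; contradiction)
open import Relation.Unary using (Pred; _∈_; _⊆_; _≐_; _∩_)

-- The interval vectors are even linearly independent, so barycentric coordinates come from linear
-- functionals on the whole space. Every pivot is 1, hence the reduction never divides and the
-- functionals keep integer entries. The delicate point is that there are no further vertices.
-- Comparison of Cauchy reals is undecidable, so one cannot simply select the `v j` at which a given
-- functional is largest. Instead, the barycentric coordinates of a point of the hull sum to 1, and
-- a positive sum has a summand that can be located as positive. For a maximizer of the functional,
-- the gap weighted by this coordinate vanishes, and a positive coordinate can be cancelled. The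
-- rest of the order arguments uses only nonnegativity. The algebra is developed over an abstract
-- commutative ring, and this record lists the order properties that the argument consumes.

record Order {c ℓ} (R : CommutativeRing c ℓ) p : Set (c Level.⊔ ℓ Level.⊔ Level.suc p) where
  open CommutativeRing R
  infix 4 _≤_
  field
    _≤_        : Carrier → Carrier → Set p
    ≤⇒0≤-      : ∀ {x y} → x ≤ y → 0# ≤ y - x
    0≤-⇒≤      : ∀ {x y} → 0# ≤ y - x → x ≤ y
    0≤-antisym : ∀ {x} → 0# ≤ x → 0# ≤ - x → x ≈ 0#
    0≤-resp-≈  : ∀ {x y} → x ≈ y → 0# ≤ x → 0# ≤ y
    0≤0        : 0# ≤ 0#
    0≤1        : 0# ≤ 1#
    0≤-+       : ∀ {x y} → 0# ≤ x → 0# ≤ y → 0# ≤ x + y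
    0≤-*       : ∀ {x y} → 0# ≤ x → 0# ≤ y → 0# ≤ x * y
    -- Constructive substitute for case distinctions on the sign: a positive sum yields a positive
    -- summand, and a positive factor cancels without being inverted.
    Positive   : Carrier → Set p
    ≈1⇒Positive       : ∀ {x} → x ≈ 1# → Positive x
    ¬Positive-0       : ¬ Positive 0#
    Positive-+        : ∀ x y → Positive (x + y) → Positive x ⊎ Positive y
    Positive-*-cancel : ∀ {x y} → Positive x → x * y ≈ 0# → y ≈ 0#

-- Finite sums and dot products over a commutative ring.

module LinearAlgebra {c ℓ} (R : CommutativeRing c ℓ) where

  open CommutativeRing R hiding (zero)
  open Sum semiring public
    using (sum; sum-cong-≋; sum-remove; ∑-distrib-+; ∑-comm; *-distribˡ-sum; *-distribʳ-sum)
  open RingProperties ring using (x[y-z]≈xy-xz; [y-z]x≈yx-zx)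
  open AbelianGroupProperties +-abelianGroup
    using (⁻¹-∙-comm; inverseʳ-unique; ε⁻¹≈ε; xyx⁻¹≈y; x∙y⁻¹≈ε⇒x≈y)
  open CommutativeSemigroupProperties *-commutativeSemigroup using (x∙yz≈y∙xz)
  open import Relation.Binary.Reasoning.Setoid setoid

  private
    variable
      d m n : ℕ

  Point : ℕ → Set c
  Point = Vector Carrier

  infix  4 _≋_
  infix  8 _·_

  _≋_ : Point n → Point n → Set ℓ
  x ≋ y = ∀ t → x t ≈ y t

  _·_ : Point n → Point n → Carrier
  x · y = sum (λ t → x t * y t)

  lincomb : (Fin m → Carrier) → (Fin m → Point n) → Point n
  lincomb c p t = sum (λ j → c j * p j t)

  sum-zero : {f : Fin m → Carrier} → (∀ j → f j ≈ 0#) → sum f ≈ 0#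
  sum-zero {ℕ.zero} h = refl
  sum-zero {suc m} h = trans (+-cong (h zero) (sum-zero (h ∘ suc))) (+-identityʳ 0#)

  sum-single : ∀ {f : Fin m → Carrier} j → (∀ k → j ≢ k → f k ≈ 0#) → sum f ≈ f j
  sum-single {suc m} {f} j h = begin
    sum f
      ≈⟨ sum-remove {i = j} f ⟩
    f j + sum (λ k → f (punchIn j k))
      ≈⟨ +-congˡ (sum-zero (λ k → h (punchIn j k) (Fin.punchInᵢ≢i j k ∘ ≡.sym))) ⟩
    f j + 0#
      ≈⟨ +-identityʳ (f j) ⟩
    f j ∎

  sum-neg : (f : Fin m → Carrier) → sum (λ j → - f j) ≈ - sum f
  sum-neg {ℕ.zero} f = sym ε⁻¹≈ε
  sum-neg {suc m} f = trans (+-congˡ (sum-neg (f ∘ suc))) (⁻¹-∙-comm _ _)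

  sum-− : (f g : Fin m → Carrier) → sum (λ j → f j - g j) ≈ sum f - sum g
  sum-− f g = trans (∑-distrib-+ f (λ j → - g j)) (+-congˡ (sum-neg g))

  sum≈0⇒rest : (f : Fin (suc m) → Carrier) → sum f ≈ 0# →
    ∀ j → sum (f ∘ punchIn j) ≈ - f j
  sum≈0⇒rest f h j = inverseʳ-unique (f j) _ (trans (sym (sum-remove {i = j} f)) h)

  sum-swap : (c : Fin m → Carrier) (f : Fin n → Fin m → Carrier) →
    sum (λ j → sum (λ k → c k * f j k)) ≈ sum (λ k → c k * sum (λ j → f j k))
  sum-swap c f = trans (∑-comm (λ j k → c k * f j k))
    (sum-cong-≋ λ k → sym (*-distribˡ-sum (c k) (λ j → f j k)))

  ·-lincomb : (a : Point n) (c : Fin m → Carrier) (p : Fin m → Point n) →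
    a · lincomb c p ≈ sum (λ k → c k * (a · p k))
  ·-lincomb a c p = begin
    sum (λ t → a t * sum (λ k → c k * p k t))
      ≈⟨ sum-cong-≋ (λ t → trans (*-distribˡ-sum (a t) (λ k → c k * p k t))
                     (sum-cong-≋ λ k → x∙yz≈y∙xz (a t) (c k) (p k t))) ⟩
    sum (λ t → sum (λ k → c k * (a t * p k t)))
      ≈⟨ sum-swap c (λ t k → a t * p k t) ⟩
    sum (λ k → c k * (a · p k)) ∎

  ·-congʳ : (a : Point n) {x y : Point n} → x ≋ y → a · x ≈ a · y
  ·-congʳ a h = sum-cong-≋ λ t → *-congˡ (h t)

  ·-+ : (a x y : Point n) → a · (λ t → x t + y t) ≈ a · x + a · y
  ·-+ a x y = trans (sum-cong-≋ λ t → distribˡ (a t) (x t) (y t))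
    (∑-distrib-+ (λ t → a t * x t) (λ t → a t * y t))

  ·-− : (a x y : Point n) → a · (λ t → x t - y t) ≈ a · x - a · y
  ·-− a x y = trans (sum-cong-≋ λ t → x[y-z]≈xy-xz (a t) (x t) (y t))
    (sum-− (λ t → a t * x t) (λ t → a t * y t))

  ·-−-scaleˡ : (a b x : Point n) (s : Carrier) →
    (λ t → a t - s * b t) · x ≈ a · x - s * (b · x)
  ·-−-scaleˡ a b x s = begin
    sum (λ t → (a t - s * b t) * x t)
      ≈⟨ sum-cong-≋ (λ t → trans ([y-z]x≈yx-zx (x t) (a t) (s * b t))
                              (+-congˡ (-‿cong (*-assoc s (b t) (x t))))) ⟩
    sum (λ t → a t * x t - s * (b t * x t))
      ≈⟨ sum-− (λ t → a t * x t) (λ t → s * (b t * x t)) ⟩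
    a · x - sum (λ t → s * (b t * x t))
      ≈⟨ +-congˡ (-‿cong (*-distribˡ-sum s (λ t → b t * x t))) ⟨
    a · x - s * (b · x) ∎

  -- Dual families and barycentric coordinates.

  record Dual (φ v : Fin m → Point n) : Set ℓ where
    field
      diagonal    : ∀ j → φ j · v j ≈ 1#
      offDiagonal : ∀ {j k} → j ≢ k → φ j · v k ≈ 0#

  module Coordinates {φ v : Fin m → Point n} (dual : Dual φ v) where

    open Dual dual

    coordinate : ∀ c j → φ j · lincomb c v ≈ c j
    coordinate c j = begin
      φ j · lincomb c v             ≈⟨ ·-lincomb (φ j) c v ⟩
      sum (λ k → c k * (φ j · v k))
        ≈⟨ sum-single j (λ k j≢k → trans (*-congˡ (offDiagonal j≢k)) (zeroʳ (c k))) ⟩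
      c j * (φ j · v j)             ≈⟨ *-congˡ (diagonal j) ⟩
      c j * 1#                      ≈⟨ *-identityʳ (c j) ⟩
      c j                           ∎

    independent : ∀ c → lincomb c v ≋ (λ _ → 0#) → ∀ j → c j ≈ 0#
    independent c h j = trans (sym (coordinate c j))
      (trans (·-congʳ (φ j) h) (sum-zero λ t → zeroʳ (φ j t)))

    -- x lies in the affine hull of v, with barycentric coordinates φ j · x.
    record Barycentric (x : Point n) : Set ℓ where
      constructor barycentric
      field
        total  : sum (λ j → φ j · x) ≈ 1#
        expand : x ≋ lincomb (λ j → φ j · x) v

    open Barycentric public

    vertex-barycentric : ∀ k → Barycentric (v k)
    vertex-barycentric k = barycentric
      (trans (sum-single k (λ j k≢j → offDiagonal (k≢j ∘ ≡.sym))) (diagonal k))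
      λ t → sym (trans
        (sum-single k λ j k≢j →
          trans (*-congʳ (offDiagonal (k≢j ∘ ≡.sym))) (zeroˡ (v j t)))
        (trans (*-congʳ (diagonal k)) (*-identityˡ (v k t))))

    resp-barycentric : ∀ {x y} → x ≋ y → Barycentric y → Barycentric x
    resp-barycentric x≋y (barycentric total expand) = barycentric
      (trans (sum-cong-≋ λ j → ·-congʳ (φ j) x≋y) total)
      λ t → trans (x≋y t) (trans (expand t)
        (sum-cong-≋ λ j → *-congʳ (·-congʳ (φ j) (sym ∘ x≋y))))

    -- Each coordinate `φ j` is linear, so both conditions pass to a combination by interchanging
    -- two sums; the total stays 1 because the weights sum to 1.
    lincomb-barycentric : ∀ {l} (c : Fin l → Carrier) (p : Fin l → Point n) →
      sum c ≈ 1# → (∀ k → Barycentric (p k)) → Barycentric (lincomb c p)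
    lincomb-barycentric c p c≈1 h = barycentric
      (begin
        sum (λ j → φ j · lincomb c p)
          ≈⟨ sum-cong-≋ (λ j → ·-lincomb (φ j) c p) ⟩
        sum (λ j → sum (λ k → c k * (φ j · p k)))
          ≈⟨ sum-swap c (λ j k → φ j · p k) ⟩
        sum (λ k → c k * sum (λ j → φ j · p k))
          ≈⟨ sum-cong-≋ (λ k → trans (*-congˡ (total (h k))) (*-identityʳ (c k))) ⟩
        sum c
          ≈⟨ c≈1 ⟩
        1# ∎)
      λ t → sym (begin
        sum (λ j → (φ j · lincomb c p) * v j t)
          ≈⟨ sum-cong-≋ (λ j → trans (*-congʳ (·-lincomb (φ j) c p))
               (trans (*-distribʳ-sum (v j t) (λ k → c k * (φ j · p k)))
                 (sum-cong-≋ λ k → *-assoc (c k) (φ j · p k) (v j t)))) ⟩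
        sum (λ j → sum (λ k → c k * ((φ j · p k) * v j t)))
          ≈⟨ sum-swap c (λ j k → (φ j · p k) * v j t) ⟩
        sum (λ k → c k * sum (λ j → (φ j · p k) * v j t))
          ≈⟨ sum-cong-≋ (λ k → *-congˡ (expand (h k) t)) ⟨
        lincomb c p t ∎)

    -- Pairing `expand` with `a` exhibits `a · x` as the mean of the values `a · v j` with weights
    -- `φ j · x`, and deviations from a mean have weighted sum 0.
    weighted-gaps : ∀ {x} → Barycentric x → (a : Point n) →
      sum (λ j → (φ j · x) * (a · x - a · v j)) ≈ 0#
    weighted-gaps {x} h a = begin
      sum (λ j → (φ j · x) * (a · x - a · v j))
        ≈⟨ sum-cong-≋ (λ j → x[y-z]≈xy-xz (φ j · x) (a · x) (a · v j)) ⟩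
      sum (λ j → (φ j · x) * (a · x) - (φ j · x) * (a · v j))
        ≈⟨ sum-− (λ j → (φ j · x) * (a · x)) (λ j → (φ j · x) * (a · v j)) ⟩
      sum (λ j → (φ j · x) * (a · x)) - sum (λ j → (φ j · x) * (a · v j))
        ≈⟨ +-cong
             (trans (sym (*-distribʳ-sum (a · x) (λ j → φ j · x)))
               (trans (*-congʳ (total h)) (*-identityˡ (a · x))))
             (-‿cong (trans (sym (·-lincomb a (λ j → φ j · x) v))
                            (·-congʳ a (sym ∘ expand h)))) ⟩
      a · x - a · x
        ≈⟨ -‿inverseʳ (a · x) ⟩
      0# ∎

  module SimplexCoordinates {φ v : Fin (suc d) → Point n} (dual : Dual φ v) where

    open Dual dual
    open Coordinates dual public

    rest : Fin (suc d) → Point n → Fin d → Carrier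
    rest k x j = φ (punchIn k j) · x

    cancel-outer : ∀ p q r → (p + q) + (r - q) ≈ p + r
    cancel-outer p q r = begin
      (p + q) + (r - q)  ≈⟨ +-congˡ (+-comm r (- q)) ⟩
      (p + q) + (- q + r)  ≈⟨ +-assoc p q (- q + r) ⟩
      p + (q + (- q + r))  ≈⟨ +-congˡ (trans (sym (+-assoc q (- q) r))
                               (trans (+-congʳ (-‿inverseʳ q)) (+-identityˡ r))) ⟩
      p + r ∎

    split-total : ∀ {x} → Barycentric x → ∀ k → φ k · x + sum (rest k x) ≈ 1#
    split-total {x} h k = trans (sym (sum-remove {i = k} (λ j → φ j · x))) (total h)

    split-expand : ∀ {x} → Barycentric x → ∀ k t →
      x t ≈ (φ k · x) * v k t + sum (λ j → rest k x j * v (punchIn k j) t)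
    split-expand {x} h k t = trans (expand h t)
      (sum-remove {i = k} (λ j → (φ j · x) * v j t))

    -- Both `φ k · v k` and the sum of all coordinates of `x` equal 1. Hence the shortfall of `φ k`
    -- at `x` is the weight that `x` puts on the other vertices, which is how `φ k` exposes `v k`.
    gap : ∀ {x} → Barycentric x → ∀ k → φ k · v k - φ k · x ≈ sum (rest k x)
    gap {x} h k = trans
      (+-congʳ (trans (diagonal k) (sym (split-total h k))))
      (xyx⁻¹≈y (φ k · x) (sum (rest k x)))

    tight⇒rest≈0 : ∀ {x} → Barycentric x → ∀ k → φ k · x ≈ φ k · v k →
      sum (rest k x) ≈ 0#
    tight⇒rest≈0 {x} h k eq = trans (sym (gap h k))
      (trans (+-congʳ (sym eq)) (-‿inverseʳ (φ k · x)))

    rest≈0⇒vertex : ∀ {x} → Barycentric x → ∀ k → (∀ j → rest k x j ≈ 0#) → x ≋ v k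
    rest≈0⇒vertex {x} h k rest≈0 t = begin
      x t
        ≈⟨ split-expand h k t ⟩
      (φ k · x) * v k t + sum (λ j → rest k x j * v (punchIn k j) t)
        ≈⟨ +-cong (*-congʳ φx≈1)
             (sum-zero λ j → trans (*-congʳ (rest≈0 j)) (zeroˡ (v (punchIn k j) t))) ⟩
      1# * v k t + 0#
        ≈⟨ trans (+-identityʳ (1# * v k t)) (*-identityˡ (v k t)) ⟩
      v k t ∎
      where
      φx≈1 : φ k · x ≈ 1#
      φx≈1 = trans (sym (+-identityʳ (φ k · x)))
        (trans (+-congˡ (sym (sum-zero rest≈0))) (split-total h k))

    module Edges (k : Fin (suc d)) {edge : Fin d → Point n}
      (edge≈ : ∀ j t → edge j t ≈ v (punchIn k j) t - v k t) where

      -- Multiply `v k t` by 1, written as the total of the coordinates: the share belonging to the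
      -- other vertices cancels against the `v k` part of the edges, and the barycentric expansion
      -- remains.
      expand-at : ∀ {x} → Barycentric x → (a : Fin d → Carrier) →
        (∀ j → rest k x j ≈ a j) → ∀ t → x t ≈ v k t + lincomb a edge t
      expand-at {x} h a rest≈a t = sym (begin
        v k t + sum (λ j → a j * edge j t)
          ≈⟨ +-cong
               (trans (sym (*-identityˡ (v k t)))
                 (trans (*-congʳ (sym (split-total h k)))
                   (distribʳ (v k t) (φ k · x) (sum (rest k x)))))
               (trans
                 (sum-cong-≋ λ j → trans (*-cong (sym (rest≈a j)) (edge≈ j t))
                   (x[y-z]≈xy-xz (rest k x j) (v (punchIn k j) t) (v k t)))
                 (sum-− (λ j → rest k x j * v (punchIn k j) t) (λ j → rest k x j * v k t))) ⟩
        ((φ k · x) * v k t + sum (rest k x) * v k t) +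
        (sum (λ j → rest k x j * v (punchIn k j) t) - sum (λ j → rest k x j * v k t))
          ≈⟨ +-congˡ (+-congˡ (-‿cong (*-distribʳ-sum (v k t) (rest k x)))) ⟨
        ((φ k · x) * v k t + sum (rest k x) * v k t) +
        (sum (λ j → rest k x j * v (punchIn k j) t) - sum (rest k x) * v k t)
          ≈⟨ cancel-outer _ _ _ ⟩
        (φ k · x) * v k t + sum (λ j → rest k x j * v (punchIn k j) t)
          ≈⟨ split-expand h k t ⟨
        x t ∎)

      -- The remaining functionals vanish at `v k`, so they take the same value on an edge as on its
      -- far endpoint. This duality makes edge coefficients unique.
      edge-dual : Dual (φ ∘ punchIn k) edge
      edge-dual = record
        { diagonal = λ j → trans (on-edge j j) (diagonal (punchIn k j))
        ; offDiagonal = λ {i} {j} i≢j →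
            trans (on-edge i j) (offDiagonal (i≢j ∘ Fin.punchIn-injective k i j)) }
        where
        on-edge : ∀ i j → φ (punchIn k i) · edge j ≈ φ (punchIn k i) · v (punchIn k j)
        on-edge i j = begin
          φ (punchIn k i) · edge j
            ≈⟨ ·-congʳ (φ (punchIn k i)) (edge≈ j) ⟩
          φ (punchIn k i) · (λ t → v (punchIn k j) t - v k t)
            ≈⟨ ·-− (φ (punchIn k i)) (v (punchIn k j)) (v k) ⟩
          φ (punchIn k i) · v (punchIn k j) - φ (punchIn k i) · v k
            ≈⟨ +-congˡ (trans (-‿cong (offDiagonal (Fin.punchInᵢ≢i k i))) ε⁻¹≈ε) ⟩
          φ (punchIn k i) · v (punchIn k j) + 0#
            ≈⟨ +-identityʳ _ ⟩
          φ (punchIn k i) · v (punchIn k j) ∎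

      rest-at : ∀ {x} (a : Fin d → Carrier) →
        (∀ t → x t ≈ v k t + lincomb a edge t) → ∀ j → rest k x j ≈ a j
      rest-at {x} a h j = begin
        φ (punchIn k j) · x
          ≈⟨ ·-congʳ (φ (punchIn k j)) h ⟩
        φ (punchIn k j) · (λ t → v k t + lincomb a edge t)
          ≈⟨ ·-+ (φ (punchIn k j)) (v k) (lincomb a edge) ⟩
        φ (punchIn k j) · v k + φ (punchIn k j) · lincomb a edge
          ≈⟨ +-cong (offDiagonal (Fin.punchInᵢ≢i k j)) (Coordinates.coordinate edge-dual a j) ⟩
        0# + a j
          ≈⟨ +-identityˡ (a j) ⟩
        a j ∎

  -- Dual functionals of a unitriangular family.

  unit : Fin n → Point n
  unit s t = if does (s Fin.≟ t) then 1# else 0#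

  unit-· : ∀ (s : Fin n) x → unit s · x ≈ x s
  unit-· s x = trans (sum-single s off) on
    where
    off : ∀ t → s ≢ t → unit s t * x t ≈ 0#
    off t s≢t with s Fin.≟ t
    ... | yes s≡t = contradiction s≡t s≢t
    ... | no _ = zeroˡ (x t)
    on : unit s s * x s ≈ x s
    on with s Fin.≟ s
    ... | yes _ = *-identityˡ (x s)
    ... | no s≢s = contradiction ≡.refl s≢s

  -- The closure hypotheses say that `P` is a subring. Carrying it through the construction lets the
  -- same reduction, instantiated at integral reals, return integral functionals.
  module _ {p} (P : Carrier → Set p)
    (P-1 : P 1#) (P-+ : ∀ {x y} → P x → P y → P (x + y))
    (P-neg : ∀ {x} → P x → P (- x)) (P-* : ∀ {x y} → P x → P y → P (x * y))
    (P-0 : P 0#) where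

    P-sum : {f : Fin m → Carrier} → (∀ j → P (f j)) → P (sum f)
    P-sum {ℕ.zero} h = P-0
    P-sum {suc m} h = P-+ (h zero) (P-sum (h ∘ suc))

    P-· : {x y : Point n} → (∀ t → P (x t)) → (∀ t → P (y t)) → P (x · y)
    P-· hx hy = P-sum λ t → P-* (hx t) (hy t)

    P-unit : ∀ (s t : Fin n) → P (unit s t)
    P-unit s t with does (s Fin.≟ t)
    ... | true = P-1
    ... | false = P-0

    -- Column reduction: clear the first vector from the functionals dual to the others.
    triangular-dual : (v : Fin m → Point n) (ι : Fin m → Fin n) →
      (∀ k t → P (v k t)) →
      (∀ j → v j (ι j) ≈ 1#) → (∀ {j k} → j Fin.< k → v k (ι j) ≈ 0#) →
      ∃ λ (φ : Fin m → Point n) → Dual φ v × (∀ j t → P (φ j t))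
    triangular-dual {ℕ.zero} v ι _ _ _ =
      (λ ()) , record { diagonal = λ () ; offDiagonal = λ { {()} } } , λ ()
    triangular-dual {suc m} {n} v ι Pv one zeros
      with φ , dual , Pφ ← triangular-dual (v ∘ suc) (ι ∘ suc) (Pv ∘ suc) (one ∘ suc)
                              (λ j<k → zeros (ℕ.s<s j<k))
      = ψ , record { diagonal = diag ; offDiagonal = off } , Pψ
      where
      open Dual dual
      s : Fin m → Carrier
      s j = φ j · v zero
      ψ : Fin (suc m) → Point n
      ψ zero = unit (ι zero)
      -- At the pivot coordinate `ι zero` the first vector is 1 and all later ones are 0, so the
      -- correction cancels the value `s j` on the first vector and leaves the values on the later
      -- ones alone.
      ψ (suc j) t = φ j t - s j * unit (ι zero) t

      ψ-suc : ∀ j k → ψ (suc j) · v k ≈ φ j · v k - s j * v k (ι zero)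
      ψ-suc j k = trans (·-−-scaleˡ (φ j) (unit (ι zero)) (v k) (s j))
        (+-congˡ (-‿cong (*-congˡ (unit-· (ι zero) (v k)))))

      ψ-suc-suc : ∀ j k → ψ (suc j) · v (suc k) ≈ φ j · v (suc k)
      ψ-suc-suc j k = begin
        ψ (suc j) · v (suc k)                       ≈⟨ ψ-suc j (suc k) ⟩
        φ j · v (suc k) - s j * v (suc k) (ι zero)
          ≈⟨ +-congˡ (-‿cong (trans (*-congˡ (zeros ℕ.z<s)) (zeroʳ (s j)))) ⟩
        φ j · v (suc k) - 0#                        ≈⟨ +-congˡ ε⁻¹≈ε ⟩
        φ j · v (suc k) + 0#                        ≈⟨ +-identityʳ (φ j · v (suc k)) ⟩
        φ j · v (suc k)                             ∎

      diag : ∀ j → ψ j · v j ≈ 1#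
      diag zero = trans (unit-· (ι zero) (v zero)) (one zero)
      diag (suc j) = trans (ψ-suc-suc j j) (diagonal j)

      off : ∀ {j k} → j ≢ k → ψ j · v k ≈ 0#
      off {zero} {zero} 0≢0 = contradiction ≡.refl 0≢0
      off {zero} {suc k} _ = trans (unit-· (ι zero) (v (suc k))) (zeros ℕ.z<s)
      off {suc j} {zero} _ = trans (ψ-suc j zero)
        (trans (+-congˡ (-‿cong (trans (*-congˡ (one zero)) (*-identityʳ (s j)))))
               (-‿inverseʳ (s j)))
      off {suc j} {suc k} j≢k = trans (ψ-suc-suc j k) (offDiagonal (j≢k ∘ ≡.cong suc))

      Pψ : ∀ j t → P (ψ j t)
      Pψ zero = P-unit (ι zero)
      Pψ (suc j) t =
        P-+ (Pφ j t) (P-neg (P-* (P-· (Pφ j) (Pv zero)) (P-unit (ι zero) t)))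

  -- Nonnegative coordinates and maxima of functionals.

  module OrderedSimplex {p} (order : Order R p)
    {φ v : Fin (suc d) → Point n} (dual : Dual φ v) where

    open Order order
    open Dual dual
    open SimplexCoordinates dual

    0≤-sum : {f : Fin m → Carrier} → (∀ j → 0# ≤ f j) → 0# ≤ sum f
    0≤-sum {ℕ.zero} h = 0≤0
    0≤-sum {suc m} h = 0≤-+ (h zero) (0≤-sum (h ∘ suc))

    -- The other summands add up to `- f j`, so `f j` and its negative are both nonnegative.
    0≤-sum≈0 : {f : Fin m → Carrier} → (∀ j → 0# ≤ f j) → sum f ≈ 0# → ∀ j → f j ≈ 0#
    0≤-sum≈0 {suc m} {f} h eq j = 0≤-antisym (h j)
      (0≤-resp-≈ (sum≈0⇒rest f eq j) (0≤-sum (h ∘ punchIn j)))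

    -- Splits off one summand at a time by `Positive-+`; running out of summands would make 0
    -- positive.
    Positive-sum : (f : Fin m → Carrier) → Positive (sum f) → ∃[ j ] Positive (f j)
    Positive-sum {ℕ.zero} f h = contradiction h ¬Positive-0
    Positive-sum {suc m} f h with Positive-+ (f zero) (sum (f ∘ suc)) h
    ... | inj₁ h₀ = zero , h₀
    ... | inj₂ h₊ = let j , hⱼ = Positive-sum (f ∘ suc) h₊ in suc j , hⱼ

    vertex-0≤ : ∀ j k → 0# ≤ φ j · v k
    vertex-0≤ j k with j Fin.≟ k
    ... | yes ≡.refl = 0≤-resp-≈ (sym (diagonal j)) 0≤1
    ... | no j≢k = 0≤-resp-≈ (sym (offDiagonal j≢k)) 0≤0

    convex-0≤ : ∀ {l x} (c : Fin l → Carrier) (p : Fin l → Point n) →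
      (∀ i → 0# ≤ c i) → (∀ i → ∃[ k ] p i ≋ v k) → x ≋ lincomb c p →
      ∀ j → 0# ≤ φ j · x
    convex-0≤ c p c≥0 p≋v x≋ j = 0≤-resp-≈
      (sym (trans (·-congʳ (φ j) x≋) (·-lincomb (φ j) c p)))
      (0≤-sum λ i → let k , pi≋vk = p≋v i in
        0≤-* (c≥0 i) (0≤-resp-≈ (sym (·-congʳ (φ j) pi≋vk)) (vertex-0≤ j k)))

    module _ {x} (bary : Barycentric x) (x≥0 : ∀ j → 0# ≤ φ j · x) where

      vertex-max : ∀ k → φ k · x ≤ φ k · v k
      vertex-max k = 0≤-⇒≤
        (0≤-resp-≈ (sym (gap bary k)) (0≤-sum (x≥0 ∘ punchIn k)))

      vertex-unique : ∀ k → φ k · x ≈ φ k · v k → x ≋ v k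
      vertex-unique k tight = rest≈0⇒vertex bary k
        (0≤-sum≈0 (x≥0 ∘ punchIn k) (tight⇒rest≈0 bary k tight))

      -- Some barycentric coordinate of x is positive, while the gaps a · x − a · v j
      -- are nonnegative with weighted sum 0.
      max-at-vertex : ∀ a → (∀ k → a · v k ≤ a · x) → ∃[ j ] a · v j ≈ a · x
      max-at-vertex a max =
        let j , j-positive = Positive-sum (λ j → φ j · x) (≈1⇒Positive (total bary))
            weighted≥0 = λ k → 0≤-* (x≥0 k) (≤⇒0≤- (max k))
            gap≈0 = Positive-*-cancel j-positive
                      (0≤-sum≈0 weighted≥0 (weighted-gaps bary a) j)
        in j , sym (x∙y⁻¹≈ε⇒x≈y (a · x) (a · v j) gap≈0)

-- The Cauchy reals as a commutative ring.

module Reals where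

  open import Defs
  open ≡ using (refl; sym; trans; cong; cong₂; subst)
  open +-*-Solver using (solve; _:+_; _:*_; :-_; _:-_; _:=_; con)

  private
    variable
      d m n : ℕ

  -- A strict inequality depends only on the difference of its sides, so every rearrangement below
  -- becomes a ring identity for the solver.
  <-shift : ∀ {p q r s} → q ℚ.- p ≡ s ℚ.- r → p ℚ.< q → r ℚ.< s
  <-shift {p} {q} {r} {s} eq p<q =
    subst₂′ (lower p r) (trans (cong (ℚ._+ r) eq) (upper r s))
      (ℚ.+-monoˡ-< r (ℚ.+-monoˡ-< (ℚ.- p) p<q))
    where
    subst₂′ : ∀ {a b c d} → a ≡ c → b ≡ d → a ℚ.< b → c ℚ.< d
    subst₂′ refl refl h = h
    lower : ∀ p r → p ℚ.- p ℚ.+ r ≡ r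
    lower = solve 2 (λ p r → p :- p :+ r := r) refl
    upper : ∀ r s → s ℚ.- r ℚ.+ r ≡ s
    upper = solve 2 (λ r s → s :- r :+ r := s) refl

  ∣∣-lub : ∀ {p ε} → p ℚ.< ε → ℚ.- p ℚ.< ε → ∣ p ∣ ℚ.< ε
  ∣∣-lub {p} {ε} p<ε -p<ε with ℚ.∣p∣≡p∨∣p∣≡-p p
  ... | inj₁ eq = subst (ℚ._< ε) (sym eq) p<ε
  ... | inj₂ eq = subst (ℚ._< ε) (sym eq) -p<ε

  p≤∣p∣ : ∀ p → p ℚ.≤ ∣ p ∣
  p≤∣p∣ p with ℚ.≤-total 0ℚ p
  ... | inj₁ 0≤p = ℚ.≤-reflexive (sym (ℚ.0≤p⇒∣p∣≡p 0≤p))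
  ... | inj₂ p≤0 = ℚ.≤-trans p≤0 (ℚ.0≤∣p∣ p)

  -∣p∣≤p : ∀ p → ℚ.- p ℚ.≤ ∣ p ∣
  -∣p∣≤p p = subst (ℚ.- p ℚ.≤_) (ℚ.∣-p∣≡∣p∣ p) (p≤∣p∣ (ℚ.- p))

  halves : ∀ ε → ½ ℚ.* ε ℚ.+ ½ ℚ.* ε ≡ ε
  halves = solve 1 (λ ε → con ½ :* ε :+ con ½ :* ε := ε) refl

  *-pos : ∀ {p q} → 0ℚ ℚ.< p → 0ℚ ℚ.< q → 0ℚ ℚ.< p ℚ.* q
  *-pos {p} {q} p>0 q>0 =
    ℚ.positive⁻¹ _ {{ℚ.pos*pos⇒pos p {{ℚ.positive p>0}} q {{ℚ.positive q>0}}}}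

  half-pos : ∀ {ε} → 0ℚ ℚ.< ε → 0ℚ ℚ.< ½ ℚ.* ε
  half-pos = *-pos (ℚ.positive⁻¹ ½)

  ∣*∣-< : ∀ {p q B δ} → ∣ p ∣ ℚ.< B → ∣ q ∣ ℚ.< δ → ∣ p ℚ.* q ∣ ℚ.< B ℚ.* δ
  ∣*∣-< {p} {q} {B} {δ} p<B q<δ = begin-strict
    ∣ p ℚ.* q ∣      ≡⟨ ℚ.∣p*q∣≡∣p∣*∣q∣ p q ⟩
    ∣ p ∣ ℚ.* ∣ q ∣  ≤⟨ ℚ.*-monoˡ-≤-nonNeg ∣ p ∣ {{ℚ.∣-∣-nonNeg p}} (ℚ.<⇒≤ q<δ) ⟩
    ∣ p ∣ ℚ.* δ      <⟨ ℚ.*-monoˡ-<-pos δ {{ℚ.positive (ℚ.≤-<-trans (ℚ.0≤∣p∣ q) q<δ)}} p<B ⟩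
    B ℚ.* δ          ∎
    where open ℚ.≤-Reasoning

  quotient : ∀ {C ε} → 0ℚ ℚ.< C → 0ℚ ℚ.< ε → ∃[ δ ] (0ℚ ℚ.< δ × C ℚ.* δ ≡ ε)
  quotient {C} {ε} C>0 ε>0 = ℚ.1/ C ℚ.* ε ,
    *-pos (ℚ.positive⁻¹ (ℚ.1/ C) {{ℚ.1/pos⇒pos C}}) ε>0 ,
    trans (sym (ℚ.*-assoc C (ℚ.1/ C) ε))
          (trans (cong (ℚ._* ε) (ℚ.*-inverseʳ C)) (ℚ.*-identityˡ ε))
    where
    instance
      C-positive = ℚ.positive C>0
      C-nonZero  = ℚ.pos⇒nonZero C

  Eventually : (ℕ → Set) → Set
  Eventually P = ∃[ N ] (∀ {n} → N ℕ.≤ n → P n)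

  map-ev : ∀ {P Q : ℕ → Set} → (∀ n → P n → Q n) → Eventually P → Eventually Q
  map-ev f (N , h) = N , λ {n} N≤n → f n (h N≤n)

  zip-ev : ∀ {P Q R : ℕ → Set} → (∀ n → P n → Q n → R n) →
           Eventually P → Eventually Q → Eventually R
  zip-ev f (M , g) (N , h) = M ⊔ N , λ {n} p →
    f n (g (ℕ.m⊔n≤o⇒m≤o M N p)) (h (ℕ.m⊔n≤o⇒n≤o M N p))

  -- The field `close` of `x ≈ y` is this predicate at the difference of the two sequences.
  -- Congruence of the ring operations thus reduces to closure properties of null sequences.
  Null : (ℕ → ℚ) → Set
  Null f = ∀ {ε} → 0ℚ ℚ.< ε → Eventually (λ n → ∣ f n ∣ ℚ.< ε)

  Null-resp : ∀ {f g} → (∀ n → f n ≡ g n) → Null f → Null g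
  Null-resp eq h ε>0 = map-ev (λ n → subst (λ q → ∣ q ∣ ℚ.< _) (eq n)) (h ε>0)

  Null-+ : ∀ {f g} → Null f → Null g → Null (λ n → f n ℚ.+ g n)
  Null-+ {f} {g} hf hg {ε} ε>0 = zip-ev
    (λ n p q → ℚ.≤-<-trans (ℚ.∣p+q∣≤∣p∣+∣q∣ (f n) (g n))
      (subst (_ ℚ.<_) (halves ε) (ℚ.+-mono-< p q)))
    (hf (half-pos ε>0)) (hg (half-pos ε>0))

  Null-neg : ∀ {f} → Null f → Null (λ n → ℚ.- f n)
  Null-neg {f} h ε>0 =
    map-ev (λ n → subst (ℚ._< _) (sym (ℚ.∣-p∣≡∣p∣ (f n)))) (h ε>0)

  Null-*ˡ : ∀ x {g} → Null g → Null (λ n → seq x n ℚ.* g n)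
  Null-*ˡ x h ε>0 =
    let B , B>0 , x<B  = eventually-bounded x
        δ , δ>0 , Bδ≡ε = quotient B>0 ε>0
    in zip-ev (λ n p q → subst (_ ℚ.<_) Bδ≡ε (∣*∣-< p q)) x<B (h δ>0)

  Null-0 : Null (λ _ → 0ℚ)
  Null-0 ε>0 = 0 , λ _ → ε>0

  pointwise : ∀ {x y} → (∀ n → seq x n ≡ seq y n) → x ≈ y
  pointwise {y = y} eq = mk≈ (Null-resp
    (λ n → sym (trans (cong (ℚ._- seq y n) (eq n)) (ℚ.+-inverseʳ (seq y n)))) Null-0)

  ≈-refl : ∀ {x} → x ≈ x
  ≈-refl = pointwise (λ _ → refl)

  ≈-sym : ∀ {x y} → x ≈ y → y ≈ x
  ≈-sym {x} {y} (mk≈ h) = mk≈ (Null-resp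
    (λ n → solve 2 (λ a b → :- (a :- b) := b :- a) refl (seq x n) (seq y n))
    (Null-neg h))

  ≈-trans : ∀ {x y z} → x ≈ y → y ≈ z → x ≈ z
  ≈-trans {x} {y} {z} (mk≈ h) (mk≈ k) = mk≈ (Null-resp
    (λ n → solve 3 (λ a b c → (a :- b) :+ (b :- c) := a :- c) refl
             (seq x n) (seq y n) (seq z n))
    (Null-+ h k))

  +-cong : ∀ {x x′ y y′} → x ≈ x′ → y ≈ y′ → x + y ≈ x′ + y′
  +-cong {x} {x′} {y} {y′} (mk≈ h) (mk≈ k) = mk≈ (Null-resp
    (λ n → solve 4 (λ a b c d → (a :- b) :+ (c :- d) := (a :+ c) :- (b :+ d)) refl
             (seq x n) (seq x′ n) (seq y n) (seq y′ n))
    (Null-+ h k))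

  -‿cong : ∀ {x y} → x ≈ y → - x ≈ - y
  -‿cong {x} {y} (mk≈ h) = mk≈ (Null-resp
    (λ n → solve 2 (λ a b → :- (a :- b) := (:- a) :- (:- b)) refl (seq x n) (seq y n))
    (Null-neg h))

  *-cong : ∀ {x x′ y y′} → x ≈ x′ → y ≈ y′ → x * y ≈ x′ * y′
  *-cong {x} {x′} {y} {y′} (mk≈ h) (mk≈ k) = mk≈ (Null-resp
    (λ n → solve 4 (λ a b c d → a :* (c :- d) :+ d :* (a :- b) := a :* c :- b :* d) refl
             (seq x n) (seq x′ n) (seq y n) (seq y′ n))
    (Null-+ (Null-*ˡ x k) (Null-*ˡ y′ h)))

  ℝ-commutativeRing : CommutativeRing 0ℓ 0ℓ
  ℝ-commutativeRing = record
    { Carrier = ℝ ; _≈_ = _≈_ ; _+_ = _+_ ; _*_ = _*_ ; -_ = -_ ; 0# = 0ℝ ; 1# = 1ℝ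
    ; isCommutativeRing = record
      { isRing = record
        { +-isAbelianGroup = record
          { isGroup = record
            { isMonoid = record
              { isSemigroup = record
                { isMagma = record
                  { isEquivalence = record
                    { refl = ≈-refl ; sym = ≈-sym ; trans = ≈-trans }
                  ; ∙-cong = +-cong }
                ; assoc = λ x y z → pointwise λ n → ℚ.+-assoc (seq x n) (seq y n) (seq z n) }
              ; identity = (λ x → pointwise λ n → ℚ.+-identityˡ (seq x n))
                         , (λ x → pointwise λ n → ℚ.+-identityʳ (seq x n)) }
            ; inverse = (λ x → pointwise λ n → ℚ.+-inverseˡ (seq x n))
                      , (λ x → pointwise λ n → ℚ.+-inverseʳ (seq x n))
            ; ⁻¹-cong = -‿cong }
          ; comm = λ x y → pointwise λ n → ℚ.+-comm (seq x n) (seq y n) }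
        ; *-cong = *-cong
        ; *-assoc = λ x y z → pointwise λ n → ℚ.*-assoc (seq x n) (seq y n) (seq z n)
        ; *-identity = (λ x → pointwise λ n → ℚ.*-identityˡ (seq x n))
                     , (λ x → pointwise λ n → ℚ.*-identityʳ (seq x n))
        ; distrib = (λ x y z → pointwise λ n → ℚ.*-distribˡ-+ (seq x n) (seq y n) (seq z n))
                  , (λ x y z → pointwise λ n → ℚ.*-distribʳ-+ (seq x n) (seq y n) (seq z n)) }
      ; *-comm = λ x y → pointwise λ n → ℚ.*-comm (seq x n) (seq y n) } }

  -- The order on the reals and constructive positivity.

  ≤⇒0≤- : ∀ {x y} → x ≤ y → 0ℝ ≤ y - x
  ≤⇒0≤- {x} {y} (mk≤ h) = mk≤ λ {ε} ε>0 → map-ev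
    (λ n → <-shift (solve 3 (λ a b ε → b :+ ε :- a := b :- a :+ ε :- con 0ℚ) refl
                      (seq x n) (seq y n) ε))
    (h ε>0)

  0≤-⇒≤ : ∀ {x y} → 0ℝ ≤ y - x → x ≤ y
  0≤-⇒≤ {x} {y} (mk≤ h) = mk≤ λ {ε} ε>0 → map-ev
    (λ n → <-shift (solve 3 (λ a b ε → b :- a :+ ε :- con 0ℚ := b :+ ε :- a) refl
                      (seq x n) (seq y n) ε))
    (h ε>0)

  0≤-antisym : ∀ {x} → 0ℝ ≤ x → 0ℝ ≤ - x → x ≈ 0ℝ
  0≤-antisym {x} (mk≤ h) (mk≤ k) = mk≈ λ {ε} ε>0 → zip-ev
    (λ n p q → ∣∣-lub
      (<-shift (solve 2 (λ a ε → (:- a) :+ ε :- con 0ℚ := ε :- (a :- con 0ℚ)) refl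
                  (seq x n) ε) q)
      (<-shift (solve 2 (λ a ε → a :+ ε :- con 0ℚ := ε :- (:- (a :- con 0ℚ))) refl
                  (seq x n) ε) p))
    (h ε>0) (k ε>0)

  0≤-resp-≈ : ∀ {x y} → x ≈ y → 0ℝ ≤ x → 0ℝ ≤ y
  0≤-resp-≈ {x} {y} (mk≈ h) (mk≤ k) = mk≤ λ {ε} ε>0 → zip-ev
    (λ n p q → <-shift
      (trans (solve 4 (λ a b η δ → a :+ δ :+ η :- (a :- b :+ con 0ℚ) := b :+ (η :+ δ) :- con 0ℚ)
                refl (seq x n) (seq y n) (½ ℚ.* ε) (½ ℚ.* ε))
             (cong (λ ε → seq y n ℚ.+ ε ℚ.- 0ℚ) (halves ε)))
      (subst (_ ℚ.<_) (solve 3 (λ η a δ → η :+ (a :+ δ) := a :+ δ :+ η) refl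
                         (½ ℚ.* ε) (seq x n) (½ ℚ.* ε))
        (ℚ.+-mono-< (ℚ.≤-<-trans (p≤∣p∣ (seq x n ℚ.- seq y n)) p) q)))
    (h (half-pos ε>0)) (k (half-pos ε>0))

  0≤-+ : ∀ {x y} → 0ℝ ≤ x → 0ℝ ≤ y → 0ℝ ≤ x + y
  0≤-+ {x} {y} (mk≤ h) (mk≤ k) = mk≤ λ {ε} ε>0 → zip-ev
    (λ n p q → subst (_ ℚ.<_)
      (trans (solve 4 (λ a b η δ → a :+ η :+ (b :+ δ) := a :+ b :+ (η :+ δ)) refl
                (seq x n) (seq y n) (½ ℚ.* ε) (½ ℚ.* ε))
             (cong (seq x n ℚ.+ seq y n ℚ.+_) (halves ε)))
      (ℚ.+-mono-< p q))
    (h (half-pos ε>0)) (k (half-pos ε>0))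

  -- The terms of a nonnegative real may be slightly negative, though above `- δ`. If a factor is
  -- negative, its absolute value is below `δ` while the other stays below `C`, so the product is
  -- within `C * δ`, that is `ε`, of 0; two nonnegative factors are harmless.
  0≤-* : ∀ {x y} → 0ℝ ≤ x → 0ℝ ≤ y → 0ℝ ≤ x * y
  0≤-* {x} {y} (mk≤ h) (mk≤ k) = mk≤ λ {ε} ε>0 →
    let A , A>0 , x<A  = eventually-bounded x
        B , B>0 , y<B  = eventually-bounded y
        -- `A + B` bounds both sequences at once, since either factor may turn out to be the small
        -- one.
        C>0            = ℚ.+-mono-< A>0 B>0
        A<C            = subst (ℚ._< A ℚ.+ B) (ℚ.+-identityʳ A) (ℚ.+-monoʳ-< A B>0)
        B<C            = subst (ℚ._< A ℚ.+ B) (ℚ.+-identityˡ B) (ℚ.+-monoˡ-< B A>0)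
        δ , δ>0 , Cδ≡ε = quotient C>0 ε>0
    in zip-ev (λ n (p , p′) (q , q′) → bound (A ℚ.+ B) δ ε ε>0 Cδ≡ε δ>0
                 (ℚ.<-trans p A<C) p′ (ℚ.<-trans q B<C) q′)
         (zip-ev (λ _ → _,_) x<A (h δ>0)) (zip-ev (λ _ → _,_) y<B (k δ>0))
    where
    small : ∀ {a b C δ ε} → C ℚ.* δ ≡ ε → 0ℚ ℚ.< δ →
            ∣ a ∣ ℚ.< C → b ℚ.< 0ℚ → 0ℚ ℚ.< b ℚ.+ δ → ∣ a ℚ.* b ∣ ℚ.< ε
    small {b = b} {δ = δ} eq δ>0 a<C b<0 b>-δ = subst (_ ℚ.<_) eq (∣*∣-< a<C (∣∣-lub
      (ℚ.<-trans b<0 δ>0)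
      (<-shift (solve 2 (λ b δ → b :+ δ :- con 0ℚ := δ :- (:- b)) refl b δ) b>-δ)))

    above : ∀ a {ε} → ∣ a ∣ ℚ.< ε → 0ℚ ℚ.< a ℚ.+ ε
    above a {ε} h = <-shift
      (solve 2 (λ a ε → ε :- (:- a) := a :+ ε :- con 0ℚ) refl a ε)
      (ℚ.≤-<-trans (-∣p∣≤p a) h)

    bound : ∀ C δ ε → 0ℚ ℚ.< ε → C ℚ.* δ ≡ ε → 0ℚ ℚ.< δ → ∀ {a b} →
            ∣ a ∣ ℚ.< C → 0ℚ ℚ.< a ℚ.+ δ → ∣ b ∣ ℚ.< C → 0ℚ ℚ.< b ℚ.+ δ →
            0ℚ ℚ.< a ℚ.* b ℚ.+ ε
    bound C δ ε ε>0 eq δ>0 {a} {b} a<C a>-δ b<C b>-δ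
      with a ℚ.<? 0ℚ | b ℚ.<? 0ℚ
    -- Only the absolute value of the product is estimated, so the sign of `a` does not matter here.
    ... | _ | yes b<0 = above (a ℚ.* b) (small eq δ>0 a<C b<0 b>-δ)
    ... | yes a<0 | no _ = above (a ℚ.* b)
      (subst (λ q → ∣ q ∣ ℚ.< ε) (ℚ.*-comm b a) (small eq δ>0 b<C a<0 a>-δ))
    ... | no a≮0 | no b≮0 = ℚ.+-mono-≤-< {0ℚ} {a ℚ.* b}
      (ℚ.nonNegative⁻¹ _ {{ℚ.nonNeg*nonNeg⇒nonNeg
        a {{ℚ.nonNegative (ℚ.≮⇒≥ a≮0)}} b {{ℚ.nonNegative (ℚ.≮⇒≥ b≮0)}}}}) ε>0

  -- An explicit rational lower bound on a tail, stronger constructively than the failure of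
  -- `x ≤ 0ℝ`.
  Positive : ℝ → Set
  Positive x = ∃[ δ ] (0ℚ ℚ.< δ × Eventually (λ n → δ ℚ.< seq x n))

  ≈1⇒Positive : ∀ {x} → x ≈ 1ℝ → Positive x
  ≈1⇒Positive {x} (mk≈ h) = ½ , ℚ.positive⁻¹ ½ , map-ev
    (λ n p → <-shift
      (solve 1 (λ a → con ½ :- (:- (a :- con 1ℚ)) := a :- con ½) refl (seq x n))
      (ℚ.≤-<-trans (-∣p∣≤p (seq x n ℚ.- 1ℚ)) p))
    (h (ℚ.positive⁻¹ ½))

  -- At a late index `K` the terms add up to more than `δ`, so one of them is at least `δ/2`; which
  -- one is a decidable question about rationals. The Cauchy property with tolerance `δ/4` keeps
  -- that sequence above `δ/4` from then on.
  Positive-+ : ∀ x y → Positive (x + y) → Positive x ⊎ Positive y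
  Positive-+ x y (δ , δ>0 , S , x+y>δ) = decide (½ ℚ.* δ ℚ.≤? seq x K)
    where
    η>0 = half-pos (half-pos δ>0)
    M = proj₁ (cauchy x η>0)
    N = proj₁ (cauchy y η>0)
    K = S ⊔ (M ⊔ N)
    M⊔N≤K = ℕ.m≤n⊔m S (M ⊔ N)

    near : ∀ a b → ½ ℚ.* δ ℚ.≤ a → ∣ a ℚ.- b ∣ ℚ.< ½ ℚ.* (½ ℚ.* δ) → ½ ℚ.* (½ ℚ.* δ) ℚ.< b
    near a b δ/2≤a h = <-shift
      (solve 3 (λ a b δ → con ½ :* (con ½ :* δ) :+ a :- (a :- b :+ con ½ :* δ)
                           := b :- con ½ :* (con ½ :* δ)) refl a b δ)
      (ℚ.+-mono-<-≤ (ℚ.≤-<-trans (p≤∣p∣ (a ℚ.- b)) h) δ/2≤a)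

    decide : Dec (½ ℚ.* δ ℚ.≤ seq x K) → Positive x ⊎ Positive y
    decide (yes δ/2≤x) = inj₁ (_ , η>0 , M , λ M≤n →
      near (seq x K) _ δ/2≤x (proj₂ (cauchy x η>0) (ℕ.m⊔n≤o⇒m≤o M N M⊔N≤K) M≤n))
    decide (no δ/2≰x) = inj₂ (_ , η>0 , N , λ N≤n →
      near (seq y K) _ (ℚ.<⇒≤ δ/2<y) (proj₂ (cauchy y η>0) (ℕ.m⊔n≤o⇒n≤o M N M⊔N≤K) N≤n))
      where
      δ/2<y : ½ ℚ.* δ ℚ.< seq y K
      δ/2<y = <-shift
        (solve 3 (λ a b δ → a :+ b :+ con ½ :* δ :- (δ :+ a) := b :- con ½ :* δ) refl
           (seq x K) (seq y K) δ)
        (ℚ.+-mono-< (x+y>δ (ℕ.m≤m⊔n S (M ⊔ N))) (ℚ.≰⇒> δ/2≰x))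

  -- With `δ` a lower bound of `x` and the product within `δ * ε` of 0, the factor `δ` cancels and
  -- leaves `ε` as bound for `y`.
  Positive-*-cancel : ∀ {x y} → Positive x → x * y ≈ 0ℝ → y ≈ 0ℝ
  Positive-*-cancel {x} {y} (δ , δ>0 , x>δ) (mk≈ h) = mk≈ λ {ε} ε>0 → zip-ev
    (λ n p q → subst (λ r → ∣ r ∣ ℚ.< ε) (sym (minus-0 (seq y n)))
      (ℚ.*-cancelˡ-<-nonNeg δ {{ℚ.nonNegative (ℚ.<⇒≤ δ>0)}} (begin-strict
        δ ℚ.* ∣ seq y n ∣
          ≤⟨ ℚ.*-monoʳ-≤-nonNeg ∣ seq y n ∣ {{ℚ.∣-∣-nonNeg (seq y n)}}
               (ℚ.≤-trans (ℚ.<⇒≤ p) (p≤∣p∣ (seq x n))) ⟩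
        ∣ seq x n ∣ ℚ.* ∣ seq y n ∣
          ≡⟨ ℚ.∣p*q∣≡∣p∣*∣q∣ (seq x n) (seq y n) ⟨
        ∣ seq x n ℚ.* seq y n ∣
          ≡⟨ cong ∣_∣ (minus-0 (seq x n ℚ.* seq y n)) ⟨
        ∣ seq x n ℚ.* seq y n ℚ.- 0ℚ ∣
          <⟨ q ⟩
        δ ℚ.* ε ∎)))
    x>δ (h (*-pos δ>0 ε>0))
    where
    open ℚ.≤-Reasoning
    minus-0 : ∀ a → a ℚ.- 0ℚ ≡ a
    minus-0 = solve 1 (λ a → a :- con 0ℚ := a) refl

  module R = CommutativeRing ℝ-commutativeRing
  module L = LinearAlgebra ℝ-commutativeRing

  -- Integers inside the reals.

  fromℚ-injective : ∀ {p q} → fromℚ p ≈ fromℚ q → p ≡ q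
  fromℚ-injective {p} {q} (mk≈ h) with p ℚ.≟ q
  ... | yes p≡q = p≡q
  ... | no p≢q =
    -- Closeness is tested at the distance of `p` and `q` itself, which would have to be smaller
    -- than itself.
    let N , k = h (ℚ.≰⇒> (p≢q ∘ equal ∘ ℚ.≤-antisym (ℚ.0≤∣p∣ (p ℚ.- q))))
    in contradiction (k {N} ℕ.≤-refl) (ℚ.<-irrefl refl)
    where
    equal : 0ℚ ≡ ∣ p ℚ.- q ∣ → p ≡ q
    equal eq = trans
      (solve 2 (λ p q → p := p :- q :+ q) refl p q)
      (trans (cong (ℚ._+ q) (ℚ.∣p∣≡0⇒p≡0 (p ℚ.- q) (sym eq))) (ℚ.+-identityˡ q))

  -- `z / 1` is normalised through a gcd and is stuck for a variable `z`. Among unnormalised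
  -- rationals it is the plain fraction, with denominator 1 stored as 0, and identities reduce to
  -- integer ones.
  toℚᵘ-/1 : ∀ z → toℚᵘ (z ℚ./ 1) ℚᵘ.≃ mkℚᵘ z 0
  toℚᵘ-/1 z = ℚ.toℚᵘ-fromℚᵘ (mkℚᵘ z 0)

  fromℤ-injective : ∀ {a b} → fromℤ a ≈ fromℤ b → a ≡ b
  fromℤ-injective {a} {b} h
    with *≡* eq ← ℚᵘ.≃-trans (ℚᵘ.≃-sym (toℚᵘ-/1 a))
                    (ℚᵘ.≃-trans (ℚᵘ.≃-reflexive (cong toℚᵘ (fromℚ-injective h))) (toℚᵘ-/1 b))
    = trans (sym (ℤ.*-identityʳ a)) (trans eq (ℤ.*-identityʳ b))

  /1-homo-+ : ∀ a b → (a ℤ.+ b) ℚ./ 1 ≡ a ℚ./ 1 ℚ.+ b ℚ./ 1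
  /1-homo-+ a b = ℚ.toℚᵘ-injective (ℚᵘ.≃-trans (toℚᵘ-/1 (a ℤ.+ b)) (ℚᵘ.≃-trans
    (*≡* (cong (ℤ._* 1ℤ) (cong₂ ℤ._+_ (sym (ℤ.*-identityʳ a)) (sym (ℤ.*-identityʳ b)))))
    (ℚᵘ.≃-sym (ℚᵘ.≃-trans (ℚ.toℚᵘ-homo-+ (a ℚ./ 1) (b ℚ./ 1))
      (ℚᵘ.+-cong (toℚᵘ-/1 a) (toℚᵘ-/1 b))))))

  /1-homo-* : ∀ a b → (a ℤ.* b) ℚ./ 1 ≡ (a ℚ./ 1) ℚ.* (b ℚ./ 1)
  /1-homo-* a b = ℚ.toℚᵘ-injective (ℚᵘ.≃-trans (toℚᵘ-/1 (a ℤ.* b)) (ℚᵘ.≃-sym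
    (ℚᵘ.≃-trans (ℚ.toℚᵘ-homo-* (a ℚ./ 1) (b ℚ./ 1))
      (ℚᵘ.*-cong (toℚᵘ-/1 a) (toℚᵘ-/1 b)))))

  /1-homo-neg : ∀ a → (ℤ.- a) ℚ./ 1 ≡ ℚ.- (a ℚ./ 1)
  /1-homo-neg a = ℚ.toℚᵘ-injective (ℚᵘ.≃-trans (toℚᵘ-/1 (ℤ.- a)) (ℚᵘ.≃-sym
    (ℚᵘ.≃-trans (ℚ.toℚᵘ-homo‿- (a ℚ./ 1)) (ℚᵘ.-‿cong (toℚᵘ-/1 a)))))

  Integral : ℝ → Set
  Integral x = ∃[ z ] x ≈ fromℤ z

  integral-+ : ∀ {x y} → Integral x → Integral y → Integral (x + y)
  integral-+ {x} {y} (a , p) (b , q) = a ℤ.+ b ,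
    ≈-trans (+-cong {x} {fromℤ a} {y} {fromℤ b} p q) (pointwise λ _ → sym (/1-homo-+ a b))

  integral-* : ∀ {x y} → Integral x → Integral y → Integral (x * y)
  integral-* {x} {y} (a , p) (b , q) = a ℤ.* b ,
    ≈-trans (*-cong {x} {fromℤ a} {y} {fromℤ b} p q) (pointwise λ _ → sym (/1-homo-* a b))

  integral-neg : ∀ {x} → Integral x → Integral (- x)
  integral-neg (a , p) = ℤ.- a ,
    ≈-trans (-‿cong p) (pointwise λ _ → sym (/1-homo-neg a))

  integral-0 : Integral 0ℝ
  integral-0 = 0ℤ , ≈-refl

  integral-1 : Integral 1ℝ
  integral-1 = 1ℤ , ≈-refl

  0≤1 : 0ℝ ≤ 1ℝ
  0≤1 = mk≤ λ ε>0 → 0 , λ _ → ℚ.+-mono-< (ℚ.positive⁻¹ 1ℚ) ε>0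

  0≤0 : 0ℝ ≤ 0ℝ
  0≤0 = mk≤ λ {ε} ε>0 → 0 , λ _ → subst (0ℚ ℚ.<_) (sym (ℚ.+-identityˡ ε)) ε>0

  1≉0 : ¬ 1ℝ ≈ 0ℝ
  1≉0 h with () ← fromℚ-injective h

  ℝ-order : Order ℝ-commutativeRing 0ℓ
  ℝ-order = record
    { _≤_        = _≤_
    ; ≤⇒0≤-      = λ {x} {y} → ≤⇒0≤- {x} {y}
    ; 0≤-⇒≤      = λ {x} {y} → 0≤-⇒≤ {x} {y}
    ; 0≤-antisym = λ {x} → 0≤-antisym {x}
    ; 0≤-resp-≈  = λ {x} {y} → 0≤-resp-≈ {x} {y}
    ; 0≤0        = 0≤0
    ; 0≤1        = 0≤1
    ; 0≤-+       = λ {x} {y} → 0≤-+ {x} {y}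
    ; 0≤-*       = λ {x} {y} → 0≤-* {x} {y}
    ; Positive   = Positive
    ; ≈1⇒Positive = λ {x} → ≈1⇒Positive {x}
    ; ¬Positive-0 = λ (_ , δ>0 , N , h) → ℚ.<-asym δ>0 (h {N} ℕ.≤-refl)
    ; Positive-+  = Positive-+
    ; Positive-*-cancel = λ {x} {y} → Positive-*-cancel {x} {y}
    }

  -- Convex and affine hulls.

  module _ {S : Pred (Point n) 0ℓ} where

    conv⊆aff : conv S ⊆ aff S
    conv⊆aff (m , p , c , p∈S , _ , c≈1 , eq) = m , p , c , p∈S , c≈1 , eq

    ⊆conv : S ⊆ conv S
    ⊆conv {x} x∈S = 1 , (λ _ → x) , (λ _ → 1ℝ) , (λ _ → x∈S) , (λ _ → 0≤1) ,
      pointwise (λ _ → refl) ,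
      λ t → pointwise λ n →
        solve 1 (λ a → a := con 1ℚ :* a :+ con 0ℚ) refl (seq (x t) n)

  ⊆aff : {S : Pred (Point n) 0ℓ} → S ⊆ aff S
  ⊆aff {S = S} x∈S = conv⊆aff {S = S} (⊆conv {S = S} x∈S)

  conv-mono : {S T : Pred (Point n) 0ℓ} → S ⊆ T → conv S ⊆ conv T
  conv-mono S⊆T (m , p , c , p∈S , rest) = m , p , c , (λ j → S⊆T (p∈S j)) , rest

  -- Taking s and v apart lets the edge vectors be compared while the vertices of s are
  -- neutral; for a concrete s the comparison would unfold the Cauchy moduli.
  unimodular : {Δ : Pred (Point n) 0ℓ} (s : IsSimplex d Δ) (v : Fin (suc d) → Point n) →
    IsSimplex.vertex s ≡ v → (∀ k → v k ∈ ℤ-lattice) →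
    (∀ k → IsLatticeBasisAt (v k) (λ j → v (punchIn k j) ⊖ v k) (ℤ-lattice ∩ aff Δ)) →
    IsUnimodularSimplex d Δ
  unimodular s _ refl lattice basis = record { simplex = s ; lattice = lattice ; basis = basis }

  -- From integral dual functionals to a unimodular simplex.

  minus≈ : ∀ x y → x - y ≈ x R.- y
  minus≈ x y = pointwise λ _ → refl

  -- Identifies the operations of the definitions with those of the ring bundle once, for arbitrary
  -- arguments.
  combination≈ : (y : ℝ) (c : Fin m → ℝ) (p : Fin m → Point n) (t : Fin n) →
    y + lincomb c p t ≈ y R.+ L.lincomb c p t
  combination≈ y c p t = ≈-refl

  integral-sum : (f : Fin m → ℝ) → (∀ j → Integral (f j)) → Integral (sum f)
  integral-sum {ℕ.zero} f h = integral-0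
  integral-sum {suc m} f h =
    integral-+ {f zero} {sum (f ∘ suc)} (h zero) (integral-sum (f ∘ suc) (h ∘ suc))

  integral-triangular-dual : (v : Fin m → Point n) (ι : Fin m → Fin n) →
    (∀ k t → Integral (v k t)) →
    (∀ j → v j (ι j) ≈ 1ℝ) → (∀ {j k} → j Fin.< k → v k (ι j) ≈ 0ℝ) →
    ∃ λ (φ : Fin m → Point n) → L.Dual φ v × (∀ j t → Integral (φ j t))
  integral-triangular-dual = L.triangular-dual Integral integral-1 (λ {x} {y} → integral-+ {x} {y})
    (λ {x} → integral-neg {x}) (λ {x} {y} → integral-* {x} {y}) integral-0

  integral-· : {x y : Point n} → x ∈ ℤ-lattice → y ∈ ℤ-lattice → Integral (x L.· y)
  integral-· = L.P-· Integral integral-1 (λ {x} {y} → integral-+ {x} {y})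
    (λ {x} → integral-neg {x}) (λ {x} {y} → integral-* {x} {y}) integral-0

  -- Independent of intervals: any integral family with integral dual functionals spans a unimodular
  -- simplex.
  module UnimodularSimplex
    {φ v : Fin (suc d) → Point n} (dual : L.Dual φ v)
    (φ-integral : ∀ j t → Integral (φ j t)) (v-integral : ∀ j t → Integral (v j t))
    {S : Pred (Point n) 0ℓ} (S≐v : S ≐ Range v) where

    open L.Dual dual
    open L.SimplexCoordinates dual
    open L.OrderedSimplex ℝ-order dual

    v∈S : ∀ j → v j ∈ S
    v∈S j = proj₂ S≐v (j , λ _ → ≈-refl)

    S-barycentric : ∀ {x} → x ∈ S → Barycentric x
    S-barycentric x∈S =
      let j , x≋v = proj₁ S≐v x∈S in resp-barycentric x≋v (vertex-barycentric j)

    -- General in `T` because it is applied twice: to `S`, which covers the polytope, and then to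
    -- the polytope, whose affine hull occurs in the dimension and in the lattice.
    aff-barycentric : {T : Pred (Point n) 0ℓ} → (∀ {x} → x ∈ T → Barycentric x) →
      ∀ {x} → x ∈ aff T → Barycentric x
    aff-barycentric T-bary (m , p , c , p∈T , c≈1 , x≋) =
      resp-barycentric x≋ (lincomb-barycentric c p c≈1 (λ j → T-bary (p∈T j)))

    conv-barycentric : ∀ {x} → x ∈ conv S → Barycentric x
    conv-barycentric x∈ = aff-barycentric {T = S} S-barycentric (conv⊆aff {S = S} x∈)

    conv-0≤ : ∀ {x} → x ∈ conv S → ∀ j → 0ℝ ≤ φ j L.· x
    conv-0≤ {x} (m , p , c , p∈S , c≥0 , _ , x≋) =
      convex-0≤ {x = x} c p c≥0 (λ i → proj₁ S≐v (p∈S i)) x≋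

    polytope : IsPolytope (conv S)
    polytope = suc d , v ,
      conv-mono {S = S} {T = Range v} (proj₁ S≐v) ,
      conv-mono {S = Range v} {T = S} (proj₂ S≐v)

    v∈conv : ∀ k → v k ∈ conv S
    v∈conv k = ⊆conv {S = S} (v∈S k)

    v∈aff : ∀ k → v k ∈ aff (conv S)
    v∈aff k = ⊆aff {S = conv S} (v∈conv k)

    affinelyIndependent : AffinelyIndependent v
    affinelyIndependent c _ = independent c

    barycentric⇒aff : ∀ {x} → Barycentric x → x ∈ aff (Range v)
    barycentric⇒aff {x} h =
      suc d , v , (λ j → φ j L.· x) , (λ j → j , λ _ → ≈-refl) , total h , expand h

    dimension : HasDimension (conv S) d
    dimension = v , v∈aff , affinelyIndependent , λ {x} x∈ →
      barycentric⇒aff {x} (aff-barycentric {T = conv S} conv-barycentric {x} x∈)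

    vertices-sound : ∀ k → IsVertex (conv S) (v k)
    vertices-sound k = v∈conv k , φ k
      , (λ {x} x∈ → vertex-max (conv-barycentric {x} x∈) (conv-0≤ {x} x∈) k)
      , (λ {x} x∈ → vertex-unique (conv-barycentric {x} x∈) (conv-0≤ {x} x∈) k)

    -- The functional that exposes `x` reaches its maximum at some `v j` as well, and exposure
    -- allows no maximizer other than `x`.
    vertices-complete : IsVertex (conv S) ⊆ Range v
    vertices-complete {x} (x∈ , a , max , exact) =
      let j , av≈ax = max-at-vertex (conv-barycentric {x} x∈) (conv-0≤ {x} x∈) a
                        (λ k → max {v k} (v∈conv k))
      in j , λ t → ≈-sym (exact {v j} (v∈conv j) av≈ax t)

    v-injective : ∀ {j k} → v j ≋ v k → j ≡ k
    v-injective {j} {k} vj≋vk with j Fin.≟ k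
    ... | yes j≡k = j≡k
    ... | no j≢k = contradiction
      (≈-trans (≈-sym (diagonal j)) (≈-trans (L.·-congʳ (φ j) vj≋vk) (offDiagonal j≢k))) 1≉0

    coordinate-integral : ∀ {x} → x ∈ ℤ-lattice → ∀ j → Integral (φ j L.· x)
    coordinate-integral x∈ℤ j = integral-· (φ-integral j) x∈ℤ

    simplex : IsSimplex d (conv S)
    simplex = record
      { polytope   = polytope
      ; dimension  = dimension
      ; vertex     = v
      ; enumerates = record
        { sound = vertices-sound ; complete = vertices-complete ; injective = v-injective } }

    private
      module E k = Edges k {edge = λ j → v (punchIn k j) ⊖ v k}
                           (λ j t → minus≈ (v (punchIn k j) t) (v k t))

    -- The coefficients are the coordinates at the other vertices, integral since both functional
    -- and point are. For uniqueness, the dual functionals recover any coefficients from `x`, and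
    -- `fromℤ` is injective.
    basis : ∀ k → IsLatticeBasisAt (v k) (λ j → v (punchIn k j) ⊖ v k) (ℤ-lattice ∩ aff (conv S))
    basis k {x} (x∈ℤ , x∈aff) =
      (λ j → proj₁ (a j))
      , (λ t → ≈-trans
          (E.expand-at k (aff-barycentric {T = conv S} conv-barycentric {x} x∈aff)
            (λ j → fromℤ (proj₁ (a j))) (λ j → proj₂ (a j)) t)
          (≈-sym (combination≈ (v k t) (λ j → fromℤ (proj₁ (a j)))
                    (λ j → v (punchIn k j) ⊖ v k) t)))
      , λ {b} x≋b j → fromℤ-injective (≈-trans (≈-sym (proj₂ (a j)))
          (E.rest-at k (λ j → fromℤ (b j))
            (λ t → ≈-trans (x≋b t)
              (combination≈ (v k t) (λ j → fromℤ (b j)) (λ j → v (punchIn k j) ⊖ v k) t)) j))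
      where
      a : ∀ j → Integral (φ (punchIn k j) L.· x)
      a j = coordinate-integral {x} x∈ℤ (punchIn k j)

    isUnimodularSimplex : IsUnimodularSimplex d (conv S)
    isUnimodularSimplex = unimodular simplex v refl v-integral basis

  -- Interval vectors and their pivots.

  e-on : ∀ {k} {t : Fin n} → k ≡ suc (toℕ t) → e k t ≈ 1ℝ
  e-on {k = k} {t} eq with k ≡ᵇ suc (toℕ t) | ℕ.≡⇒≡ᵇ k (suc (toℕ t)) eq
  ... | true | _ = ≈-refl

  e-off : ∀ {k} {t : Fin n} → k ≢ suc (toℕ t) → e k t ≈ 0ℝ
  e-off {k = k} {t} neq with k ≡ᵇ suc (toℕ t) | ℕ.≡ᵇ⇒≡ k (suc (toℕ t))
  ... | true  | equal = contradiction (equal tt) neq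
  ... | false | _     = ≈-refl

  e-integral : ∀ k (t : Fin n) → Integral (e k t)
  e-integral k t with k ≡ᵇ suc (toℕ t)
  ... | true  = integral-1
  ... | false = integral-0

  α-integral : ∀ k l (t : Fin n) → Integral (α k l t)
  α-integral k l t = integral-sum {suc l ℕ.∸ k}
    (λ j → e (k ℕ.+ toℕ j) t) (λ j → e-integral (k ℕ.+ toℕ j) t)

  -- The parameters are one less than the dimension of the space and the interval length, so that
  -- `suc n ∸ suc i` reduces to `n ∸ i`.
  module Intervals (n i : ℕ) where

    interval : Fin (suc (n ℕ.∸ i)) → Point (suc n)
    interval k = α (suc (toℕ k)) (suc (toℕ k) ℕ.+ suc i ℕ.∸ 1)

    interval-integral : ∀ k t → Integral (interval k t)
    interval-integral k = α-integral (suc (toℕ k)) (suc (toℕ k) ℕ.+ suc i ℕ.∸ 1)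

    -- The coordinate of the leading 1 of each interval.
    pivot : Fin (suc (n ℕ.∸ i)) → Fin (suc n)
    pivot j = inject≤ j (s≤s (ℕ.m∸n≤m n i))

    toℕ-pivot : ∀ j → toℕ (pivot j) ≡ toℕ j
    toℕ-pivot j = Fin.toℕ-inject≤ j (s≤s (ℕ.m∸n≤m n i))

    off-start : ∀ {j k} → toℕ j ℕ.< k → ∀ l → e (suc k ℕ.+ l) (pivot j) ≈ 0ℝ
    off-start {j} {k} j<k l = e-off λ eq → ℕ.<⇒≢
      (ℕ.<-≤-trans j<k (ℕ.m≤m+n k l)) (sym (trans (ℕ.suc-injective eq) (toℕ-pivot j)))

    interval-before : ∀ {j k} → j Fin.< k → interval k (pivot j) ≈ 0ℝ
    interval-before {j} {k} j<k =
      L.sum-zero {suc (suc (toℕ k) ℕ.+ suc i ℕ.∸ 1) ℕ.∸ suc (toℕ k)}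
        {f = λ l → e (suc (toℕ k) ℕ.+ toℕ l) (pivot j)} (λ l → off-start j<k (toℕ l))

    interval-start : ∀ k → interval k (pivot k) ≈ 1ℝ
    interval-start k = from-length _ (ℕ.m+n∸m≡n (toℕ k) (suc i))
      where
      -- The length of the sum in `α` reduces to `toℕ k + suc i ∸ toℕ k`, which equals `suc i` only
      -- propositionally. Abstracting it exposes the first summand, the only one that meets the
      -- pivot.
      from-length : ∀ m → m ≡ suc i →
        sum {m} (λ l → e (suc (toℕ k) ℕ.+ toℕ l) (pivot k)) ≈ 1ℝ
      from-length _ refl = ≈-trans
        (L.sum-single {suc i} {f = λ l → e (suc (toℕ k) ℕ.+ toℕ l) (pivot k)} zero off)
        (e-on (cong suc (trans (ℕ.+-identityʳ (toℕ k)) (sym (toℕ-pivot k)))))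
        where
        off : ∀ (l : Fin (suc i)) → zero ≢ l → e (suc (toℕ k) ℕ.+ toℕ l) (pivot k) ≈ 0ℝ
        off zero 0≢0 = contradiction refl 0≢0
        off (suc l) _ = e-off λ eq → ℕ.m+1+n≢m (toℕ k) (trans (ℕ.suc-injective eq) (toℕ-pivot k))

    ℐ≐interval : ℐ (suc n) (suc i) ≐ Range interval
    ℐ≐interval = to , from
      where
      to : ∀ {x} → x ∈ ℐ (suc n) (suc i) → x ∈ Range interval
      to {x} (suc k , _ , k≤ , x≋α) = fromℕ< k< ,
        subst (λ k → x ≋ α (suc k) (suc k ℕ.+ suc i ℕ.∸ 1)) (sym (Fin.toℕ-fromℕ< k<)) x≋α
        where
        k< : k ℕ.< suc (n ℕ.∸ i)
        -- `ℐ` numbers intervals from 1 up to `n ∸ i + 1`, while `Fin` counts from 0.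
        k< = subst (suc k ℕ.≤_) (ℕ.+-comm (n ℕ.∸ i) 1) k≤
      from : ∀ {x} → x ∈ Range interval → x ∈ ℐ (suc n) (suc i)
      from (j , x≋α) = suc (toℕ j) , s≤s z≤n ,
        subst (suc (toℕ j) ℕ.≤_) (ℕ.+-comm 1 (n ℕ.∸ i)) (Fin.toℕ<n j) , x≋α

open import Defs using (IsUnimodularSimplex; 𝒫; ℐ)
open import Data.Nat using (_≤_; _∸_)

theorem3 : (n i : ℕ) → 1 ≤ i → i ≤ n → IsUnimodularSimplex (n ∸ i) (𝒫 n (ℐ n i))
-- A length of at least 1 supplies the leading entry that serves as pivot.
theorem3 (suc n) (suc i) (s≤s z≤n) (s≤s _) =
  let φ , dual , φ-integral = Reals.integral-triangular-dual
        interval pivot interval-integral interval-start interval-before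
  in Reals.UnimodularSimplex.isUnimodularSimplex dual φ-integral interval-integral ℐ≐interval
  where open Reals.Intervals n i
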